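{- Let $\mathcal{V}$ be a strongly irregular variety of a plural type (possibly with constants) and let $\mathbf{A}$ be the P\l onka sum over a semilattice direct system $\mathbb{A}=(\{\mathbf{A}_i\}_{i\in I},(I,\le),\{p_{ij}\}_{i\le j})$ of algebras in $\mathcal{V}$. Let $R\subseteq A\times A$, $R_{uv}:=R\cap(A_u\times A_v)$, $S_R:=\{(u,v)\in I\times I\mid R_{uv}\neq\emptyset\}$, and let $C\in Con(\mathbf{I})$ be such that $S_R\subseteq C$. For $i\in I$ let $\Psi_i$ be the congruence of $\mathbf{A}_i$ generated by $\bigcup_{u,v\le i}(p_{ui}\times p_{vi})(R_{uv})$, and let $S_C^{\Psi}:=\{(i,j)\in C\mid (p_{i,i\vee j}\times p_{j,i\vee j})^{ -1}(\Psi_{i\vee j})\ne\emptyset\}$. For every $i\in I$ define a binary relation $\theta_{ii}$ on $A_i$ by: $(a,b)\in\theta_{ii}$ if and only if there exists $k\in I$ with $i\le k$, $(i,k)\in S_C^{\Psi}$ and $(p_{ik}(a),p_{ik}(b))\in\Psi_k$. Then $\theta_{ii}\in Con(\mathbf{A}_i)$ for every $i\in I$, $(C,\{\theta_{ii}\}_{i\in I})$ is a congruence on the direct system $\mathbb{A}$, and its associated congruence $\theta$ on $\mathbf{A}$ satisfies $R\subseteq\theta$. In particular, for every $C\in Con(\mathbf{I})$ there exists $\theta\in Con(\mathbf{A})$ such that $C_\theta=C$.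
   Context: A type is plural if it contains at least one operation symbol of arity at least $2$. A variety $\mathcal{V}$ is strongly irregular if there is a binary term $f(x,y)$, in which both variables actually occur, such that $\mathcal{V}\models f(x,y)\approx x$. A semilattice direct system $\mathbb{A}=(\{\mathbf{A}_i\}_{i\in I},(I,\le),\{p_{ij}\}_{i\le j})$ consists of a join-semilattice $\mathbf{I}=(I,\le)$ with join $\vee$ (required to have a least element $i_0$ when the type contains constants), algebras $\mathbf{A}_i$ of the same type with pairwise disjoint universes, and homomorphisms $p_{ij}\colon\mathbf{A}_i\to\mathbf{A}_j$ for $i\le j$ with $p_{ii}=\mathrm{id}$ and $p_{ik}=p_{jk}\circ p_{ij}$ for $i\le j\le k$. Its P\l onka sum is the algebra with universe $A=\bigcup_{i\in I}A_i$ in which, for every $n$-ary operation $g$ with $n\ge1$ and $a_1\in A_{i_1},\dots,a_n\in A_{i_n}$, $g(a_1,\dots,a_n)=g^{\mathbf{A}_j}(p_{i_1j}(a_1),\dots,p_{i_nj}(a_n))$ with $j=i_1\vee\dots\vee i_n$, and every constant $c$ is interpreted as $c^{\mathbf{A}_{i_0}}$. Notation: $(p\times q)(a,b)=(p(a),q(b))$. Given $C\in Con(\mathbf{I})$ and a family $\theta_{ii}\in Con(\mathbf{A}_i)$, let $S_C^{\theta}:=\{(i,j)\in C\mid (p_{i,i\vee j}\times p_{j,i\vee j})^{ -1}(\theta_{i\vee j,i\vee j})\ne\emptyset\}$. A congruence on $\mathbb{A}$ is a pair $(C,\{\theta_{ii}\}_{i\in I})$ such that: (i) $C\in Con(\mathbf{I})$;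 (ii) $\theta_{ii}\in Con(\mathbf{A}_i)$ for every $i$; (iii) $\theta_{ii}\subseteq(p_{i,i\vee j}\times p_{i,i\vee j})^{ -1}(\theta_{i\vee j,i\vee j})$ for all $i,j\in I$; (iv) equality holds in (iii) for all $(i,j)\in S_C^{\theta}$. Its associated congruence on $\mathbf{A}$ is $\theta:=\bigcup_{(i,j)\in S_C^{\theta}}(p_{i,i\vee j}\times p_{j,i\vee j})^{ -1}(\theta_{i\vee j,i\vee j})$ (for $i=j$ this is $\theta_{ii}$); it is known to be a congruence of $\mathbf{A}$. For $\theta\in Con(\mathbf{A})$: $S_\theta:=\{(i,j)\in I\times I\mid\theta\cap(A_i\times A_j)\neq\emptyset\}$ and $C_\theta:=\{(i,j)\in I\times I\mid (i,i\vee j),(j,i\vee j)\in S_\theta\}$. -}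

module Defs where

open import Data.Fin.Base using (Fin; zero; suc)
open import Data.Nat.Base using (ℕ; zero; suc; _≤_)
open import Data.Product.Base using (Σ; Σ-syntax; ∃; ∃-syntax; _×_; _,_; proj₁; proj₂)
open import Data.Vec.Functional using (Vector; tail)
open import Data.Vec.Functional.Relation.Binary.Pointwise using (Pointwise)
open import Level using (Level; _⊔_) renaming (suc to lsuc)
open import Relation.Binary.Bundles using (Setoid)
open import Relation.Binary.Core using (Rel; REL; _⇒_; _⇔_)
open import Relation.Binary.Definitions using (Minimum; NonEmpty)
open import Relation.Binary.Lattice.Bundles using (JoinSemilattice)
open import Relation.Binary.Structures using (IsEquivalence)
open import Relation.Binary.PropositionalEquality.Core using (_≡_; refl)
import Algebra.Definitions
import Relation.Binary.Lattice.Properties.JoinSemilattice as JoinProperties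

private
  variable
    o a b c e ℓ r ι ι₁ ι₂ x : Level

record Signature (o : Level) : Set (lsuc o) where
  field
    Symbol : Set o
    arity  : Symbol → ℕ

  Constant : Set o
  Constant = Σ[ f ∈ Symbol ] arity f ≡ 0

Plural : Signature o → Set o
Plural 𝓕 = ∃[ f ] 2 ≤ Signature.arity 𝓕 f

-- Sets are setoids throughout.  Universes may be empty here; non-emptiness is
-- imposed on the members of a direct system below.
record Algebra (𝓕 : Signature o) (a ℓ : Level) : Set (o ⊔ lsuc (a ⊔ ℓ)) where
  open Signature 𝓕
  field
    setoid : Setoid a ℓ

  open Setoid setoid public

  field
    ⟦_⟧     : (f : Symbol) → Vector Carrier (arity f) → Carrier
    ⟦⟧-cong : ∀ f {xs ys} → Pointwise _≈_ xs ys → ⟦ f ⟧ xs ≈ ⟦ f ⟧ ys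

∣_∣ : {𝓕 : Signature o} → Algebra 𝓕 a ℓ → Set a
∣_∣ = Algebra.Carrier

record Hom {𝓕 : Signature o} (𝐀 𝐁 : Algebra 𝓕 a ℓ) : Set (o ⊔ a ⊔ ℓ) where
  private
    module A = Algebra 𝐀
    module B = Algebra 𝐁
  field
    map  : A.Carrier → B.Carrier
    cong : ∀ {x y} → x A.≈ y → map x B.≈ map y
    homo : ∀ f xs → map (A.⟦ f ⟧ xs) B.≈ B.⟦ f ⟧ (λ k → map (xs k))

open Hom public using (map)

-- Congruences of a setoid algebra contain its underlying equality.
record IsCongruence {𝓕 : Signature o} (𝐀 : Algebra 𝓕 a ℓ) (θ : Rel ∣ 𝐀 ∣ c) :
                    Set (o ⊔ a ⊔ ℓ ⊔ c) where
  open Algebra 𝐀 using (_≈_; ⟦_⟧)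
  field
    isEquivalence : IsEquivalence θ
    ≈⇒            : _≈_ ⇒ θ
    compatible    : ∀ f {xs ys} → Pointwise θ xs ys → θ (⟦ f ⟧ xs) (⟦ f ⟧ ys)

-- The least congruence containing X.
data Cg {𝓕 : Signature o} (𝐀 : Algebra 𝓕 a ℓ) (X : Rel ∣ 𝐀 ∣ r) :
        Rel ∣ 𝐀 ∣ (o ⊔ a ⊔ ℓ ⊔ r) where
  cg-gen   : ∀ {x y} → X x y → Cg 𝐀 X x y
  cg-≈     : ∀ {x y} → Algebra._≈_ 𝐀 x y → Cg 𝐀 X x y
  cg-sym   : ∀ {x y} → Cg 𝐀 X x y → Cg 𝐀 X y x
  cg-trans : ∀ {x y z} → Cg 𝐀 X x y → Cg 𝐀 X y z → Cg 𝐀 X x z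
  cg-op    : ∀ f {xs ys} → Pointwise (Cg 𝐀 X) xs ys →
             Cg 𝐀 X (Algebra.⟦_⟧ 𝐀 f xs) (Algebra.⟦_⟧ 𝐀 f ys)

data Term (𝓕 : Signature o) (X : Set x) : Set (o ⊔ x) where
  var : X → Term 𝓕 X
  app : (f : Signature.Symbol 𝓕) → Vector (Term 𝓕 X) (Signature.arity 𝓕 f) → Term 𝓕 X

data _OccursIn_ {𝓕 : Signature o} {X : Set x} (v : X) : Term 𝓕 X → Set (o ⊔ x) where
  here  : v OccursIn var v
  there : ∀ {f ts} k → v OccursIn ts k → v OccursIn app f ts

eval : {𝓕 : Signature o} {X : Set x} (𝐀 : Algebra 𝓕 a ℓ) → (X → ∣ 𝐀 ∣) → Term 𝓕 X → ∣ 𝐀 ∣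
eval 𝐀 ρ (var v)    = ρ v
eval 𝐀 ρ (app f ts) = Algebra.⟦_⟧ 𝐀 f (λ k → eval 𝐀 ρ (ts k))

_⊨_≋_ : {𝓕 : Signature o} {X : Set x} → Algebra 𝓕 a ℓ → Term 𝓕 X → Term 𝓕 X → Set (x ⊔ a ⊔ ℓ)
𝐀 ⊨ s ≋ t = ∀ ρ → Algebra._≈_ 𝐀 (eval 𝐀 ρ s) (eval 𝐀 ρ t)

-- A variety is the class of models of a set of identities.
record Variety (𝓕 : Signature o) (e : Level) : Set (o ⊔ lsuc e) where
  field
    Identity : Rel (Term 𝓕 ℕ) e

_∈ᵥ_ : {𝓕 : Signature o} → Algebra 𝓕 a ℓ → Variety 𝓕 e → Set (o ⊔ a ⊔ ℓ ⊔ e)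
𝐀 ∈ᵥ 𝓥 = ∀ {s t} → Variety.Identity 𝓥 s t → 𝐀 ⊨ s ≋ t

-- The levels a, ℓ are those of the algebras over which 𝓥 ⊨ t ≈ x ranges.
StronglyIrregular : {𝓕 : Signature o} (a ℓ : Level) → Variety 𝓕 e → Set (o ⊔ lsuc (a ⊔ ℓ) ⊔ e)
StronglyIrregular {𝓕 = 𝓕} a ℓ 𝓥 =
  Σ[ t ∈ Term 𝓕 (Fin 2) ]
    zero OccursIn t × suc zero OccursIn t ×
    (∀ (𝐀 : Algebra 𝓕 a ℓ) → 𝐀 ∈ᵥ 𝓥 → 𝐀 ⊨ t ≋ var zero)

record IsSemilatticeCongruence (𝐈 : JoinSemilattice ι ι₁ ι₂)
                               (C : Rel (JoinSemilattice.Carrier 𝐈) c) :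
                               Set (ι ⊔ ι₁ ⊔ c) where
  open JoinSemilattice 𝐈 using (_≈_; _∨_)
  open Algebra.Definitions C using (Congruent₂)
  field
    isEquivalence : IsEquivalence C
    ≈⇒            : _≈_ ⇒ C
    ∨-compatible  : Congruent₂ _∨_

-- The transition maps depend on a proof of i ≤ j, but p-id and p-comp, being
-- stated for all proofs, make them independent of it up to ≈.  In particular,
-- i ≈ j gives mutually inverse isomorphisms between 𝐀 i and 𝐀 j.
record DirectSystem (𝓕 : Signature o) (ι ι₁ ι₂ a ℓ : Level) :
                    Set (o ⊔ lsuc (ι ⊔ ι₁ ⊔ ι₂ ⊔ a ⊔ ℓ)) where
  field
    semilattice : JoinSemilattice ι ι₁ ι₂

  open JoinSemilattice semilattice public
    using (_≈_; _∨_; x≤x∨y; y≤x∨y; reflexive)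
    renaming (Carrier to I; _≤_ to _≼_)

  field
    i₀         : Signature.Constant 𝓕 → I
    i₀-minimum : ∀ c → Minimum _≼_ (i₀ c)
    𝐀          : I → Algebra 𝓕 a ℓ
    nonempty   : ∀ i → ∣ 𝐀 i ∣
    p          : ∀ {i j} → i ≼ j → Hom (𝐀 i) (𝐀 j)
    p-id       : ∀ {i} (q : i ≼ i) x → Algebra._≈_ (𝐀 i) (map (p q) x) x
    p-comp     : ∀ {i j k} (q : i ≼ j) (r : j ≼ k) (s : i ≼ k) x →
                 Algebra._≈_ (𝐀 k) (map (p s) x) (map (p r) (map (p q) x))

module PłonkaSum {𝓕 : Signature o} (𝔸 : DirectSystem 𝓕 ι ι₁ ι₂ a ℓ) where
  open Signature 𝓕
  open DirectSystem 𝔸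
  private
    module I = JoinSemilattice semilattice
    module A i = Algebra (𝐀 i)

  ⋁ : ∀ n → (n ≡ 0 → I) → Vector I n → I
  ⋁ zero          least is = least refl
  ⋁ (suc zero)    least is = is zero
  ⋁ (suc (suc n)) least is = is zero ∨ ⋁ (suc n) (λ ()) (tail is)

  ≤⋁ : ∀ n least (is : Vector I n) k → is k ≼ ⋁ n least is
  ≤⋁ (suc zero)    least is zero    = I.refl
  ≤⋁ (suc (suc n)) least is zero    = x≤x∨y _ _
  ≤⋁ (suc (suc n)) least is (suc k) =
    I.trans (≤⋁ (suc n) (λ ()) (tail is) k) (y≤x∨y _ _)

  ⋁-cong : ∀ n least {is js : Vector I n} → Pointwise _≈_ is js → ⋁ n least is ≈ ⋁ n least js
  ⋁-cong zero          least eq = I.Eq.refl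
  ⋁-cong (suc zero)    least eq = eq zero
  ⋁-cong (suc (suc n)) least eq =
    JoinProperties.∨-cong semilattice (eq zero) (⋁-cong (suc n) (λ ()) (λ k → eq (suc k)))

  index : (f : Symbol) → Vector I (arity f) → I
  index f = ⋁ (arity f) (λ eq → i₀ (f , eq))

  ≤index : ∀ f is k → is k ≼ index f is
  ≤index f = ≤⋁ (arity f) _

  Carrier : Set (ι ⊔ a)
  Carrier = Σ[ i ∈ I ] ∣ 𝐀 i ∣

  -- Tagging with the index makes the universes disjoint; for equal indices,
  -- elements are compared along the transition isomorphism.
  _≈ₛ_ : Rel Carrier (ι₁ ⊔ ℓ)
  (i , x) ≈ₛ (j , y) = Σ[ eq ∈ i ≈ j ] A._≈_ j (map (p (reflexive eq)) x) y

  op : (f : Symbol) → Vector Carrier (arity f) → Carrier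
  op f xs = j , A.⟦_⟧ j f (λ k → map (p (≤index f is k)) (proj₂ (xs k)))
    where
    is = λ k → proj₁ (xs k)
    j  = index f is

  ≈ₛ-isEquivalence : IsEquivalence _≈ₛ_
  ≈ₛ-isEquivalence = record
    { refl  = λ {(i , x)} → I.Eq.refl , p-id _ x
    ; sym   = λ {(i , x)} {(j , y)} (eq , x≈y) →
        I.Eq.sym eq ,
        A.trans i (Hom.cong (p _) (A.sym j x≈y))
          (A.trans i (A.sym i (p-comp _ _ I.refl x)) (p-id _ x))
    ; trans = λ {(i , x)} {(j , y)} {(k , z)} (eq , x≈y) (eq′ , y≈z) →
        I.Eq.trans eq eq′ ,
        A.trans k (p-comp _ _ _ x) (A.trans k (Hom.cong (p _) x≈y) y≈z)
    }

  op-cong : ∀ f {xs ys} → Pointwise _≈ₛ_ xs ys → op f xs ≈ₛ op f ys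
  op-cong f {xs} {ys} eq = ij , A.trans j (Hom.homo (p _) f _) (A.⟦⟧-cong j f λ k →
      A.trans j (A.sym j (p-comp _ _ (I.trans (≤index f is k) (reflexive ij)) _))
        (A.trans j (p-comp _ _ _ _) (Hom.cong (p (≤index f js k)) (proj₂ (eq k)))))
    where
    is = λ k → proj₁ (xs k)
    js = λ k → proj₁ (ys k)
    ij : index f is ≈ index f js
    ij = ⋁-cong (arity f) _ (λ k → proj₁ (eq k))
    j  = index f js

  sum : Algebra 𝓕 (ι ⊔ a) (ι₁ ⊔ ℓ)
  sum = record
    { setoid  = record { isEquivalence = ≈ₛ-isEquivalence }
    ; ⟦_⟧     = op
    ; ⟦⟧-cong = op-cong
    }

Płonka : {𝓕 : Signature o} → DirectSystem 𝓕 ι ι₁ ι₂ a ℓ → Algebra 𝓕 (ι ⊔ a) (ι₁ ⊔ ℓ)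
Płonka = PłonkaSum.sum

-- preimage h k θ = (h × k)⁻¹(θ)
preimage : {A : Set a} {B : Set b} {D : Set c} → (A → D) → (B → D) → Rel D r → REL A B r
preimage h k θ x y = θ (h x) (k y)

module _ {𝓕 : Signature o} (𝔸 : DirectSystem 𝓕 ι ι₁ ι₂ a ℓ) where
  open DirectSystem 𝔸

  Family : (c : Level) → Set (ι ⊔ a ⊔ lsuc c)
  Family c = (i : I) → Rel ∣ 𝐀 i ∣ c

  -- (p_{i,i∨j} × p_{j,i∨j})⁻¹(θ_{i∨j,i∨j})
  pullback : Family c → (i j : I) → REL ∣ 𝐀 i ∣ ∣ 𝐀 j ∣ c
  pullback θ i j = preimage (map (p (x≤x∨y i j))) (map (p (y≤x∨y i j))) (θ (i ∨ j))

  S : Rel I c → Family r → Rel I (a ⊔ c ⊔ r)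
  S C θ i j = C i j × NonEmpty (pullback θ i j)

  -- θ-resp expresses that θ is a family over the setoid I; it is trivial when
  -- equality of indices is _≡_.
  record IsSystemCongruence (C : Rel I c) (θ : Family r) :
                            Set (o ⊔ ι ⊔ ι₁ ⊔ a ⊔ ℓ ⊔ c ⊔ r) where
    field
      C-congruence : IsSemilatticeCongruence semilattice C
      θ-resp       : ∀ {i j} (eq : i ≈ j) →
                     let h = map (p (reflexive eq)) in θ i ⇒ preimage h h (θ j)
      θ-congruence : ∀ i → IsCongruence (𝐀 i) (θ i)
      θ-⊆          : ∀ i j → let h = map (p (x≤x∨y i j)) in
                     θ i ⇒ preimage h h (θ (i ∨ j))
      θ-≡          : ∀ i j → S C θ i j → let h = map (p (x≤x∨y i j)) in
                     θ i ⇔ preimage h h (θ (i ∨ j))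

  associated : Rel I c → Family r → Rel ∣ Płonka 𝔸 ∣ (a ⊔ c ⊔ r)
  associated C θ (i , x) (j , y) = S C θ i j × pullback θ i j x y

  restrict : Rel ∣ Płonka 𝔸 ∣ r → (u v : I) → REL ∣ 𝐀 u ∣ ∣ 𝐀 v ∣ r
  restrict R u v x y = R (u , x) (v , y)

  support : Rel ∣ Płonka 𝔸 ∣ r → Rel I (a ⊔ r)
  support R u v = NonEmpty (restrict R u v)

  -- C_θ
  indexRelation : Rel ∣ Płonka 𝔸 ∣ r → Rel I (a ⊔ r)
  indexRelation θ i j = support θ i (i ∨ j) × support θ j (i ∨ j)

  -- ⋃_{u,v≤i} (p_{ui} × p_{vi})(R_{uv})
  generators : Rel ∣ Płonka 𝔸 ∣ r → Family (ι ⊔ ι₂ ⊔ a ⊔ ℓ ⊔ r)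
  generators R i x y =
    ∃[ u ] ∃[ v ] Σ[ u≤i ∈ u ≼ i ] Σ[ v≤i ∈ v ≼ i ]
    ∃[ x′ ] ∃[ y′ ] restrict R u v x′ y′ × map (p u≤i) x′ ≈ᵢ x × map (p v≤i) y′ ≈ᵢ y
    where open Algebra (𝐀 i) using () renaming (_≈_ to _≈ᵢ_)

  Ψ : Rel ∣ Płonka 𝔸 ∣ r → Family (o ⊔ ι ⊔ ι₂ ⊔ a ⊔ ℓ ⊔ r)
  Ψ R i = Cg (𝐀 i) (generators R i)

  Θ : Rel I c → Rel ∣ Płonka 𝔸 ∣ r → Family (o ⊔ ι ⊔ ι₂ ⊔ a ⊔ ℓ ⊔ c ⊔ r)
  Θ C R i x y =
    ∃[ k ] Σ[ i≤k ∈ i ≼ k ] S C (Ψ R) i k × Ψ R k (map (p i≤k) x) (map (p i≤k) y)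

-- Call elements x ∈ A_i and y ∈ A_j related when some k ≥ i, j in the C-class
-- of both satisfies (p_ik x, p_jk y) ∈ Ψ_k.  Since C-classes are closed under joins
-- and the Ψ_k are carried along the transition maps, finitely many such k may be
-- replaced by a single one, so this is a congruence of the Płonka sum.  Both Θ and
-- its associated relation are restrictions of it: the non-emptiness condition in
-- S_C^Ψ holds for comparable indices, as x is related to p_ik x.
module Submission where

open import Defs
open import Data.Empty.Polymorphic using (⊥)
open import Data.Fin.Base using (zero; suc)
open import Data.Nat.Base using (zero; suc)
open import Data.Product.Base using (Σ-syntax; ∃-syntax; _×_; _,_; proj₁; proj₂)
open import Data.Vec.Functional using (Vector; tail)
open import Data.Vec.Functional.Relation.Binary.Pointwise using (Pointwise)
open import Level using (Level; _⊔_; 0ℓ)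
open import Relation.Binary.Core using (Rel; _⇒_; _⇔_)
open import Relation.Binary.Definitions using (nonEmpty)
open import Relation.Binary.Lattice.Bundles using (JoinSemilattice)
open import Relation.Binary.Structures using (IsEquivalence)
import Relation.Binary.Lattice.Properties.JoinSemilattice as JoinProperties

private
  variable
    o a ℓ r s ι ι₁ ι₂ : Level

-- The preimage of a congruence under a homomorphism is a congruence, so only the generators need
-- checking.
Cg-map : {𝓕 : Signature o} {𝐀 𝐁 : Algebra 𝓕 a ℓ} (h : Hom 𝐀 𝐁)
         {X : Rel ∣ 𝐀 ∣ r} {Y : Rel ∣ 𝐁 ∣ s} →
         X ⇒ preimage (map h) (map h) Y →
         Cg 𝐀 X ⇒ preimage (map h) (map h) (Cg 𝐁 Y)
Cg-map h X⇒Y (cg-gen x)     = cg-gen (X⇒Y x)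
Cg-map h X⇒Y (cg-≈ eq)      = cg-≈ (Hom.cong h eq)
Cg-map h X⇒Y (cg-sym q)     = cg-sym (Cg-map h X⇒Y q)
Cg-map h X⇒Y (cg-trans q t) = cg-trans (Cg-map h X⇒Y q) (Cg-map h X⇒Y t)
Cg-map {𝐁 = 𝐁} h X⇒Y (cg-op f {xs} {ys} qs) =
  cg-trans (cg-≈ (Hom.homo h f xs))
    (cg-trans (cg-op f (λ n → Cg-map h X⇒Y (qs n)))
      (cg-≈ (Algebra.sym 𝐁 (Hom.homo h f ys))))

module _ {𝓕 : Signature o} (𝔸 : DirectSystem 𝓕 ι ι₁ ι₂ a ℓ) where
  open Signature 𝓕
  open DirectSystem 𝔸
  open PłonkaSum 𝔸 using (Carrier; _≈ₛ_; ⋁; ≤index)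

  private
    module I = JoinSemilattice semilattice
    module A i = Algebra (𝐀 i)

  -- Transport of the congruences Ψ along transition maps.

  module _ {r} (R : Rel Carrier r) where

    generators-map : ∀ {i j} (q : i ≼ j) → let h = map (p q) in
                     generators 𝔸 R i ⇒ preimage h h (generators 𝔸 R j)
    generators-map {j = j} q (u , v , u≤i , v≤i , x′ , y′ , xRy , ex , ey) =
      u , v , I.trans u≤i q , I.trans v≤i q , x′ , y′ , xRy ,
      A.trans j (p-comp _ _ _ x′) (Hom.cong (p q) ex) ,
      A.trans j (p-comp _ _ _ y′) (Hom.cong (p q) ey)

    -- The order proofs are arbitrary because `p` takes them as arguments; with `k = l` this also
    -- exchanges one proof for another.
    Ψ-lift : ∀ {i j k l x y} (i≤k : i ≼ k) (j≤k : j ≼ k) (i≤l : i ≼ l) (j≤l : j ≼ l) → k ≼ l →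
             Ψ 𝔸 R k (map (p i≤k) x) (map (p j≤k) y) →
             Ψ 𝔸 R l (map (p i≤l) x) (map (p j≤l) y)
    Ψ-lift {l = l} {x} {y} i≤k j≤k i≤l j≤l k≤l ψ =
      cg-trans (cg-≈ (p-comp i≤k k≤l i≤l x))
        (cg-trans (Cg-map (p k≤l) (generators-map k≤l) ψ)
          (cg-≈ (A.sym l (p-comp j≤k k≤l j≤l y))))

    module _ {c} (C : Rel I c) (isC : IsSemilatticeCongruence semilattice C) where
      open IsSemilatticeCongruence isC using (∨-compatible)
      private
        module C = IsSemilatticeCongruence isC
        module CE = IsEquivalence C.isEquivalence

      -- Classes of C and finite joins.

      C-≈ˡ : ∀ {i j k} → i ≈ j → C i k → C j k
      C-≈ˡ eq Cik = CE.trans (C.≈⇒ (I.Eq.sym eq)) Cik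

      C-∨ : ∀ {i k l} → C i k → C i l → C i (k ∨ l)
      C-∨ Cik Cil = C-≈ˡ (JoinProperties.∨-idempotent semilattice _) (∨-compatible Cik Cil)

      -- Joining both sides of `C i k` with `j` works since `i ∨ j ≈ j`. A witness index for `i`
      -- thus yields one for any larger `j`, even outside the class of `i`.
      C-absorb : ∀ {i j k} → i ≼ j → C i k → C j (k ∨ j)
      C-absorb i≤j Cik =
        C-≈ˡ (JoinProperties.x≤y⇒x∨y≈y semilattice i≤j) (∨-compatible Cik CE.refl)

      ⋁-compatible : ∀ n least {is js : Vector I n} → Pointwise C is js →
                     C (⋁ n least is) (⋁ n least js)
      ⋁-compatible zero          least cs = CE.refl
      ⋁-compatible (suc zero)    least cs = cs zero
      ⋁-compatible (suc (suc n)) least cs =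
        ∨-compatible (cs zero) (⋁-compatible (suc n) (λ ()) (λ k → cs (suc k)))

      -- The joins start from `i` itself, so the bound lies above `i` even for `n = 0`, the case of
      -- constants.
      common-bound : ∀ n i (ks : Vector I n) → (∀ m → C i (ks m)) →
                     ∃[ k ] i ≼ k × C i k × (∀ m → ks m ≼ k)
      common-bound zero    i ks cs = i , I.refl , CE.refl , λ ()
      common-bound (suc n) i ks cs with common-bound n i (tail ks) (λ m → cs (suc m))
      ... | k , i≤k , Cik , ks≤k =
        ks zero ∨ k , I.trans i≤k (y≤x∨y _ _) , C-∨ (cs zero) Cik ,
        λ { zero → x≤x∨y _ _ ; (suc m) → I.trans (ks≤k m) (y≤x∨y _ _) }

      -- The congruence ∼ of the Płonka sum.

      infix 4 _∼_
      _∼_ : Rel Carrier _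
      (i , x) ∼ (j , y) =
        ∃[ k ] Σ[ i≤k ∈ i ≼ k ] Σ[ j≤k ∈ j ≼ k ]
          C i k × C j k × Ψ 𝔸 R k (map (p i≤k) x) (map (p j≤k) y)

      ∼-transition : ∀ {i j} (i≤j : i ≼ j) → C i j → ∀ x → (i , x) ∼ (j , map (p i≤j) x)
      ∼-transition {j = j} i≤j Cij x =
        j , i≤j , I.refl , Cij , CE.refl , cg-≈ (A.sym j (p-id _ _))

      ≈ₛ⇒∼ : _≈ₛ_ ⇒ _∼_
      ≈ₛ⇒∼ {i , x} {j , y} (eq , x≈y) =
        j , reflexive eq , I.refl , C.≈⇒ eq , CE.refl ,
        cg-≈ (A.trans j x≈y (A.sym j (p-id _ y)))

      ∼-isEquivalence : IsEquivalence _∼_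
      ∼-isEquivalence = record
        { refl  = λ {(i , x)} → i , I.refl , I.refl , CE.refl , CE.refl , cg-≈ (A.refl i)
        ; sym   = λ (k , i≤k , j≤k , Cik , Cjk , ψ) → k , j≤k , i≤k , Cjk , Cik , cg-sym ψ
        ; trans = λ (k , i≤k , j≤k , Cik , Cjk , ψ) (l , j≤l , m≤l , Cjl , Cml , φ) →
            let k≤k∨l = x≤x∨y k l
                l≤k∨l = y≤x∨y k l
                -- The middle index `j` is C-related to both witnesses, hence to their join; the
                -- outer indices reach that join through `j`.
                Cjkl  = C-∨ Cjk Cjl
            in  k ∨ l , I.trans i≤k k≤k∨l , I.trans m≤l l≤k∨l ,
                CE.trans Cik (CE.trans (CE.sym Cjk) Cjkl) ,
                CE.trans Cml (CE.trans (CE.sym Cjl) Cjkl) ,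
                cg-trans (Ψ-lift i≤k j≤k _ (I.trans j≤k k≤k∨l) k≤k∨l ψ)
                  (Ψ-lift j≤l m≤l _ _ l≤k∨l φ)
        }

      private
        module ∼ = IsEquivalence ∼-isEquivalence

      ∼⇒C : ∀ {i j x y} → (i , x) ∼ (j , y) → C i j
      ∼⇒C (_ , _ , _ , Cik , Cjk , _) = CE.trans Cik (CE.sym Cjk)

      -- Applied with i = j this gives compatibility in the fibre over i, and with
      -- the joins of the indices it gives compatibility in the Płonka sum.
      ∼-op : ∀ f (xs ys : Vector Carrier (arity f)) {i j}
             (is≤i : ∀ n → proj₁ (xs n) ≼ i) (js≤j : ∀ n → proj₁ (ys n) ≼ j) →
             C i j → (∀ n → xs n ∼ ys n) →
             (i , A.⟦_⟧ i f (λ n → map (p (is≤i n)) (proj₂ (xs n)))) ∼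
             (j , A.⟦_⟧ j f (λ n → map (p (js≤j n)) (proj₂ (ys n))))
      ∼-op f xs ys {i} {j} is≤i js≤j Cij xs∼ys =
        K , i≤K , j≤K ,
        CE.trans Ciu CuK , CE.trans (CE.sym Cij) (CE.trans Ciu CuK) ,
        cg-trans (cg-≈ (Hom.homo (p i≤K) f _))
          (cg-trans
            (cg-op f λ n →
              let (k , i≤k , j≤k , _ , _ , ψ) = xs∼ys n in
              cg-trans (cg-≈ (A.sym K (p-comp (is≤i n) i≤K (I.trans (is≤i n) i≤K) _)))
                (cg-trans
                  (Ψ-lift i≤k j≤k _ (I.trans (js≤j n) j≤K) (I.trans (x≤x∨y k u) (ks≤K n)) ψ)
                  (cg-≈ (p-comp (js≤j n) j≤K _ _))))
            (cg-≈ (A.sym K (Hom.homo (p j≤K) f _))))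
        where
        u = i ∨ j
        Ciu : C i u
        Ciu = C-∨ CE.refl Cij
        -- The witness for the `n`-th arguments need not lie in the class of `u`. Its join with `u`
        -- does, since the index of `xs n` is below `u`.
        bound = common-bound (arity f) u (λ n → proj₁ (xs∼ys n) ∨ u) λ n →
          let (_ , _ , _ , Cik , _) = xs∼ys n in
          C-absorb (I.trans (is≤i n) (x≤x∨y i j)) Cik
        K    = proj₁ bound
        u≤K  = proj₁ (proj₂ bound)
        CuK  = proj₁ (proj₂ (proj₂ bound))
        ks≤K = proj₂ (proj₂ (proj₂ bound))
        i≤K  = I.trans (x≤x∨y i j) u≤K
        j≤K  = I.trans (y≤x∨y i j) u≤K

      ∼-isCongruence : IsCongruence (Płonka 𝔸) _∼_
      ∼-isCongruence = record
        { isEquivalence = ∼-isEquivalence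
        ; ≈⇒            = ≈ₛ⇒∼
        ; compatible    = λ f {xs} {ys} xs∼ys →
            ∼-op f xs ys (≤index f _) (≤index f _)
              (⋁-compatible (arity f) _ (λ n → ∼⇒C (xs∼ys n))) xs∼ys
        }

      -- Θ and its associated relation as restrictions of ∼.

      Θ⇒∼ : ∀ {i x y} → Θ 𝔸 C R i x y → (i , x) ∼ (i , y)
      Θ⇒∼ (k , i≤k , (Cik , _) , ψ) = k , i≤k , i≤k , Cik , Cik , ψ

      Θ-intro : ∀ {i k x y} (i≤k : i ≼ k) → C i k →
                Ψ 𝔸 R k (map (p i≤k) x) (map (p i≤k) y) → Θ 𝔸 C R i x y
      Θ-intro {k = k} {x} i≤k Cik ψ =
        k , i≤k , (Cik , nonEmpty (cg-≈ (p-comp i≤k _ _ x))) , ψ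

      ∼⇒Θ : ∀ {i x y} → (i , x) ∼ (i , y) → Θ 𝔸 C R i x y
      ∼⇒Θ (k , i≤k , i≤k′ , Cik , _ , ψ) =
        -- The two sides may use different proofs of `i ≼ k`; lifting along `I.refl` makes them
        -- agree.
        Θ-intro i≤k Cik (Ψ-lift i≤k i≤k′ i≤k i≤k I.refl ψ)

      associated⇒∼ : associated 𝔸 C (Θ 𝔸 C R) ⇒ _∼_
      associated⇒∼ ((Cij , _) , θxy) =
        ∼.trans (∼-transition _ (C-∨ CE.refl Cij) _)
          (∼.trans (Θ⇒∼ θxy) (∼.sym (∼-transition _ (C-∨ (CE.sym Cij) CE.refl) _)))

      ∼⇒associated : _∼_ ⇒ associated 𝔸 C (Θ 𝔸 C R)
      -- The related pair itself witnesses the non-emptiness required by `S`.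
      ∼⇒associated {i , x} {j , y} x∼y = (Cij , nonEmpty θxy) , θxy
        where
        Cij = ∼⇒C x∼y
        θxy = ∼⇒Θ (∼.trans (∼.sym (∼-transition (x≤x∨y i j) (C-∨ CE.refl Cij) x))
                (∼.trans x∼y (∼-transition (y≤x∨y i j) (C-∨ (CE.sym Cij) CE.refl) y)))

      Θ-isCongruence : ∀ i → IsCongruence (𝐀 i) (Θ 𝔸 C R i)
      Θ-isCongruence i = record
        { isEquivalence = record
          { refl  = ∼⇒Θ ∼.refl
          ; sym   = λ q → ∼⇒Θ (∼.sym (Θ⇒∼ q))
          ; trans = λ q t → ∼⇒Θ (∼.trans (Θ⇒∼ q) (Θ⇒∼ t))
          }
        ; ≈⇒         = λ eq → Θ-intro I.refl CE.refl (cg-≈ (Hom.cong (p I.refl) eq))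
        -- `∼-op` shifts every argument by `p I.refl`, which is the identity only up to `≈`;
        -- `unshift` removes the shift.
        ; compatible = λ f {xs} {ys} xsθys → ∼⇒Θ
            (∼.trans (≈ₛ⇒∼ (unshift f xs))
              (∼.trans
                (∼-op f _ _ (λ _ → I.refl) (λ _ → I.refl) CE.refl (λ n → Θ⇒∼ (xsθys n)))
                (∼.sym (≈ₛ⇒∼ (unshift f ys)))))
        }
        where
        unshift : ∀ f xs → (i , A.⟦_⟧ i f xs) ≈ₛ (i , A.⟦_⟧ i f (λ n → map (p I.refl) (xs n)))
        unshift f xs =
          I.Eq.refl , A.trans i (p-id _ _) (A.⟦⟧-cong i f λ n → A.sym i (p-id _ _))

      -- Without `C i j`, `∼-transition` cannot relate `x` to its image. Instead the witness `k` is
      -- replaced by `k ∨ j`, C-related to `j` by `C-absorb`.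
      Θ-map : ∀ {i j} (i≤j : i ≼ j) → let h = map (p i≤j) in
              Θ 𝔸 C R i ⇒ preimage h h (Θ 𝔸 C R j)
      Θ-map {j = j} i≤j (k , i≤k , (Cik , _) , ψ) =
        Θ-intro (y≤x∨y k j) (C-absorb i≤j Cik)
          (cg-trans (cg-≈ (A.sym (k ∨ j) (p-comp _ _ i≤k∨j _)))
            (cg-trans (Ψ-lift i≤k i≤k i≤k∨j i≤k∨j (x≤x∨y k j) ψ) (cg-≈ (p-comp _ _ _ _))))
        where i≤k∨j = I.trans i≤k (x≤x∨y k j)

      Θ-isSystemCongruence : IsSystemCongruence 𝔸 C (Θ 𝔸 C R)
      Θ-isSystemCongruence = record
        { C-congruence = isC
        ; θ-resp       = λ eq → Θ-map (reflexive eq)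
        ; θ-congruence = Θ-isCongruence
        ; θ-⊆          = λ i j → Θ-map (x≤x∨y i j)
        ; θ-≡          = λ i j (Cij , _) →
            -- Here `C i j` holds, so elements are ∼-related to their images and Θ is reflected as
            -- well as preserved.
            let up = ∼-transition (x≤x∨y i j) (C-∨ CE.refl Cij) in
            Θ-map (x≤x∨y i j) ,
            λ θxy → ∼⇒Θ (∼.trans (up _) (∼.trans (Θ⇒∼ θxy) (∼.sym (up _))))
        }

      associated-isCongruence : IsCongruence (Płonka 𝔸) (associated 𝔸 C (Θ 𝔸 C R))
      associated-isCongruence = record
        { isEquivalence = record
          { refl  = ∼⇒associated ∼.refl
          ; sym   = λ q → ∼⇒associated (∼.sym (associated⇒∼ q))
          ; trans = λ q t → ∼⇒associated (∼.trans (associated⇒∼ q) (associated⇒∼ t))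
          }
        ; ≈⇒         = λ eq → ∼⇒associated (≈ₛ⇒∼ eq)
        ; compatible = λ f qs → ∼⇒associated
            (IsCongruence.compatible ∼-isCongruence f (λ n → associated⇒∼ (qs n)))
        }

      -- The images of an R-pair in the fibre over `i ∨ j` form a generator of Ψ there, and the
      -- support condition puts `i ∨ j` in the class of both indices.
      R⇒associated : support 𝔸 R ⇒ C → R ⇒ associated 𝔸 C (Θ 𝔸 C R)
      R⇒associated S⇒C {i , x} {j , y} xRy = ∼⇒associated
        ( i ∨ j , i≤ , j≤ , C-∨ CE.refl Cij , C-∨ (CE.sym Cij) CE.refl
        , cg-gen (i , j , i≤ , j≤ , x , y , xRy , A.refl (i ∨ j) , A.refl (i ∨ j)))
        where
        Cij = S⇒C (nonEmpty xRy)
        i≤  = x≤x∨y i j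
        j≤  = y≤x∨y i j

      -- Forwards, `i` and `j` are both C-related to `i ∨ j`. Backwards, a point of each nonempty
      -- fibre is ∼-related to its image over `i ∨ j`.
      indexRelation-associated : indexRelation 𝔸 (associated 𝔸 C (Θ 𝔸 C R)) ⇔ C
      indexRelation-associated =
        (λ (nonEmpty ((Ciu , _) , _) , nonEmpty ((Cju , _) , _)) → CE.trans Ciu (CE.sym Cju)) ,
        λ {i} {j} Cij →
          linked (x≤x∨y i j) (C-∨ CE.refl Cij) ,
          linked (y≤x∨y i j) (C-∨ (CE.sym Cij) CE.refl)
        where
        linked : ∀ {i k} → i ≼ k → C i k → support 𝔸 (associated 𝔸 C (Θ 𝔸 C R)) i k
        linked {i} i≤k Cik =
          nonEmpty (∼⇒associated (∼-transition i≤k Cik (nonempty i)))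

theorem11 : ∀ {o e ι ι₁ ι₂ a ℓ r c : Level} {𝓕 : Signature o} → Plural 𝓕 →
    (𝓥 : Variety 𝓕 e) → StronglyIrregular a ℓ 𝓥 →
    (𝔸 : DirectSystem 𝓕 ι ι₁ ι₂ a ℓ) → let open DirectSystem 𝔸 in
    (∀ i → 𝐀 i ∈ᵥ 𝓥) →
    ((R : Rel ∣ Płonka 𝔸 ∣ r) (C : Rel I c) →
    IsSemilatticeCongruence semilattice C → support 𝔸 R ⇒ C →
    (∀ i → IsCongruence (𝐀 i) (Θ 𝔸 C R i)) ×
    IsSystemCongruence 𝔸 C (Θ 𝔸 C R) ×
    IsCongruence (Płonka 𝔸) (associated 𝔸 C (Θ 𝔸 C R)) ×
    R ⇒ associated 𝔸 C (Θ 𝔸 C R)) ×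
    ((C : Rel I c) → IsSemilatticeCongruence semilattice C →
    Σ[ θ ∈ Rel ∣ Płonka 𝔸 ∣ (o ⊔ ι ⊔ ι₂ ⊔ a ⊔ ℓ ⊔ c) ]
    IsCongruence (Płonka 𝔸) θ × indexRelation 𝔸 θ ⇔ C)
theorem11 _ _ _ 𝔸 _ =
  (λ R C isC S⇒C →
    Θ-isCongruence 𝔸 R C isC , Θ-isSystemCongruence 𝔸 R C isC ,
    associated-isCongruence 𝔸 R C isC , R⇒associated 𝔸 R C isC S⇒C) ,
  λ C isC →
    -- With R empty each Ψ is the equality of its fibre, so θ identifies elements exactly when their
    -- images agree at some index in their common C-class.
    associated 𝔸 C (Θ 𝔸 C ∅) , associated-isCongruence 𝔸 ∅ C isC ,
    indexRelation-associated 𝔸 ∅ C isC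
  where
  ∅ : Rel ∣ Płonka 𝔸 ∣ 0ℓ
  ∅ _ _ = ⊥
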